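{- Let $AP$ be a finite non-empty set of atomic propositions, let $M[\mathtt{var}]$ be a Finite Query Automaton over $AP$ with finite transition relation, and let $SC=\mathit{ShatterFQA}(M[\mathtt{var}])$ be the set of propositional intervals computed by the procedure $\mathit{ShatterFQA}$ described in the context. Then, for every propositional formula $\gamma$ over $AP$, $\gamma$ shatters $M[\mathtt{var}]$ (i.e. $L(M[\gamma])=\emptyset$) if and only if $\gamma\in[\gamma',\gamma'']$ for some $[\gamma',\gamma'']\in SC$.
   Context: **Propositional formulas.** $\Gamma$ is the set of formulas built from $a\in AP$ with $\neg,\wedge$ (with $\vee$, $\mathit{true}$, $\mathit{false}$ derived as usual). They are interpreted over finite, possibly empty, sequences $\pi$ of subsets of $AP$: $\pi\models a$ iff $\pi$ is non-empty and $a$ belongs to its first element; $\neg,\wedge$ as usual. $\varepsilon$ is the empty sequence. $\llbracket\gamma\rrbracket=\{\pi\mid\pi\models\gamma\}$; $\gamma$ is unsatisfiable iff $\llbracket\gamma\rrbracket=\emptyset$. Write $\gamma_1\le\gamma_2$ iff $\llbracket\gamma_2\rrbracket\subseteq\llbracket\gamma_1\rrbracket$ (weaker formulas are smaller). The propositional interval is $[\gamma_1,\gamma_2]=\{\gamma\in\Gamma\mid\gamma_1\le\gamma\le\gamma_2\}$. Let $[\mathit{true}]_{\sim_\varepsilon}=\{\gamma\in\Gamma\mid\varepsilon\models\gamma\}$ and $[\mathit{false}]_{\sim_\varepsilon}=\{\gamma\in\Gamma\mid\varepsilon\not\models\gamma\}$; these equal the intervals $[\mathit{true},\bigwedge_{a\in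 AP}\neg a]$ and $[\bigvee_{a\in AP}a,\mathit{false}]$. **Propositional queries.** $\Gamma[\mathtt{var}]$ is the set of expressions built from $\mathtt{var}$ and $a\in AP$ with $\neg,\wedge$; $\gamma[\gamma']$ denotes replacing every $\mathtt{var}$ in $\gamma[\mathtt{var}]$ by $\gamma'\in\Gamma$. $\gamma'$ shatters $\gamma[\mathtt{var}]$ iff $\gamma[\gamma']$ is unsatisfiable. The shattering interval $I_{\gamma[\mathtt{var}]}$ is the set of all $\gamma'\in\Gamma$ shattering $\gamma[\mathtt{var}]$; it is either empty or a propositional interval. For a finite set of intervals $\{[\gamma_i',\gamma_i'']\}_i$, put $\bigwedge_i[\gamma_i',\gamma_i'']=[\bigwedge_i\gamma_i',\bigvee_i\gamma_i'']$, which as a set equals the intersection of the intervals; for the empty set of intervals this is $[\mathit{true},\mathit{false}]=\Gamma$. **PNFA.** A propositional NFA is $(Q,AP,q_I,\delta,F)$ with $Q$ a finite set, $q_I\in Q$, $F\subseteq Q$, $\delta\subseteq Q\times\Gamma\times Q$. State $q$ accepts $w\in(2^{AP})^*$ iff $w=\varepsilon$ and $q\in F$, or $w=Aw'$ with $A\subseteq AP$ and there is $(q,\gamma,q')\in\delta$ with $A\models\gamma$ ($A$ viewed as a length-one sequence) and $q'$ accepts $w'$. $L(M)$ is the set of $w$ accepted by $q_I$. **FQA.** A Finite Query Automaton is $M[\mathtt{var}]=(Q,AP,q_I,\delta[\mathtt{var}],F[\mathtt{var}])$ with $Q$ a finite set, $q_I\in Q$, $\delta[\mathtt{var}]\subseteq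 Q\times\Gamma[\mathtt{var}]\times Q$, $F[\mathtt{var}]:Q\to\Gamma[\mathtt{var}]$. For $\gamma\in\Gamma$, $M[\gamma]$ is the PNFA $(Q,AP,q_I,\delta[\gamma],F[\gamma])$ with $\delta[\gamma]=\{(q,\gamma'[\gamma],q')\mid(q,\gamma'[\mathtt{var}],q')\in\delta[\mathtt{var}]\}$ and $F[\gamma]=\{q\mid\varepsilon\models(F[\mathtt{var}](q))[\gamma]\}$. **Procedure $\mathit{ShatterFQA}(M[\mathtt{var}])$.** Preprocessing: let $TL$ be the set of all labels of transitions in $\delta[\mathtt{var}]$; $UL=\{\gamma[\mathtt{var}]\in TL\mid I_{\gamma[\mathtt{var}]}=\emptyset\}$; $DL=\{\gamma[\mathtt{var}]\in TL\mid I_{\gamma[\mathtt{var}]}=[\mathit{true},\mathit{false}]\}$; $SL=TL\setminus(UL\cup DL)$; $\delta'[\mathtt{var}]=\{(q,\gamma[\mathtt{var}],q')\in\delta[\mathtt{var}]\mid\gamma[\mathtt{var}]\in SL\}\cup\{(q,\mathit{true},q')\mid\exists\gamma[\mathtt{var}]\in UL,\ (q,\gamma[\mathtt{var}],q')\in\delta[\mathtt{var}]\}$. Main: start with $SC=\emptyset$. For each $S\subseteq SL$: let $I_S=\bigwedge\{I_{\gamma[\mathtt{var}]}\mid\gamma[\mathtt{var}]\in S\}$, $PSC=\emptyset$, $\delta''=\{(q,\mathit{true},q')\mid(q,\gamma[\mathtt{var}],q')\in\delta'[\mathtt{var}],\ \gamma[\mathtt{var}]\notin S\}$. If $I_S\cap[\mathit{true}]_{\sim_\varepsilon}\ne\emptyset$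 and the PNFA $M_t=(Q,AP,q_I,\delta'',F[\mathit{true}])$ has $L(M_t)=\emptyset$, add $I_S\cap[\mathit{true}]_{\sim_\varepsilon}$ to $PSC$. If $I_S\cap[\mathit{false}]_{\sim_\varepsilon}\neq\emptyset$ and the PNFA $M_f=(Q,AP,q_I,\delta'',F[\mathit{false}])$ has $L(M_f)=\emptyset$, add $I_S\cap[\mathit{false}]_{\sim_\varepsilon}$ to $PSC$. If $|PSC|=2$, add $I_S$ to $SC$; otherwise add all elements of $PSC$ to $SC$. After all $S$ are processed, return $SC$. -}

module Defs where

open import Level using (0ℓ)
open import Data.Bool using (if_then_else_)
open import Data.Empty using (⊥; ⊥-elim)
open import Data.Unit using (⊤; tt)
open import Data.Nat using (ℕ; suc; _≟_)
open import Data.Fin using (Fin; zero)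
import Data.Fin.Properties as Fin
open import Data.Fin.Subset as Subset using (Subset; ⁅_⁆)
import Data.Fin.Subset.Properties as Subset
open import Data.Fin.Subset.Induction using (Acc; acc; ⊃-wellFounded)
open import Data.List
  using (List; []; _∷_; [_]; _++_; map; concatMap; filter; foldr; length; allFin; deduplicate)
open import Data.List.Membership.Propositional using (_∈_; find; lose)
open import Data.List.Membership.Propositional.Properties using (∈-allFin)
import Data.List.Membership.DecPropositional as DecMembership
open import Data.List.Relation.Unary.Any using (Any; here; there; any?)
open import Data.Product using (∃; ∃-syntax; ∃₂; _×_; _,_; proj₁; proj₂)
open import Data.Sum using ([_,_]′)
open import Data.Vec using (tabulate)
open import Function using (_∘_; _⇔_; mk⇔; Equivalence)
open import Relation.Nullary
  using (¬_; Dec; yes; no; does; ¬?; map′; contradiction; decidable-stable; _×-dec_)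
open import Relation.Unary using (Pred; Empty; Satisfiable; _⊆′_; _≐′_; _∩_)
open import Relation.Binary using (DecidableEquality)
open import Relation.Binary.PropositionalEquality using (_≡_; refl; cong; cong₂)

open Equivalence using (to; from)

------------------------------------------------------------------------
-- Propositional formulas and queries

-- The non-empty finite set AP is Fin (suc m).  A formula (element of Γ)
-- has no variables; a query (element of Γ[var]) has the single variable
-- var = var tt.

infix  9 ¬ᶠ_
infixr 8 _∧ᶠ_
infixr 7 _∨ᶠ_

data Exp (V : Set) (m : ℕ) : Set where
  var  : V → Exp V m
  atom : Fin (suc m) → Exp V m
  ¬ᶠ_  : Exp V m → Exp V m
  _∧ᶠ_ : Exp V m → Exp V m → Exp V m

Formula : ℕ → Set
Formula = Exp ⊥

Query : ℕ → Set
Query = Exp ⊤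

variable
  m k : ℕ
  V   : Set

_∨ᶠ_ : Exp V m → Exp V m → Exp V m
φ ∨ᶠ ψ = ¬ᶠ (¬ᶠ φ ∧ᶠ ¬ᶠ ψ)

falseᶠ : Exp V m
falseᶠ = atom zero ∧ᶠ ¬ᶠ atom zero

trueᶠ : Exp V m
trueᶠ = ¬ᶠ falseᶠ

⋀ᶠ : List (Formula m) → Formula m
⋀ᶠ = foldr _∧ᶠ_ trueᶠ

⋁ᶠ : List (Formula m) → Formula m
⋁ᶠ = foldr _∨ᶠ_ falseᶠ

infix 10 _⟨_⟩

_⟨_⟩ : Query m → Formula m → Formula m
var _    ⟨ γ ⟩ = γ
atom a   ⟨ γ ⟩ = atom a
(¬ᶠ φ)   ⟨ γ ⟩ = ¬ᶠ (φ ⟨ γ ⟩)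
(φ ∧ᶠ ψ) ⟨ γ ⟩ = (φ ⟨ γ ⟩) ∧ᶠ (ψ ⟨ γ ⟩)

infix 4 _≟ᑫ_

_≟ᑫ_ : DecidableEquality (Query m)
var tt ≟ᑫ var tt = yes refl
var _ ≟ᑫ atom _ = no λ ()
var _ ≟ᑫ ¬ᶠ _ = no λ ()
var _ ≟ᑫ _ ∧ᶠ _ = no λ ()
atom _ ≟ᑫ var _ = no λ ()
atom a ≟ᑫ atom b = map′ (cong atom) (λ { refl → refl }) (a Fin.≟ b)
atom _ ≟ᑫ ¬ᶠ _ = no λ ()
atom _ ≟ᑫ _ ∧ᶠ _ = no λ ()
¬ᶠ _ ≟ᑫ var _ = no λ ()
¬ᶠ _ ≟ᑫ atom _ = no λ ()
¬ᶠ φ ≟ᑫ ¬ᶠ ψ = map′ (cong ¬ᶠ_) (λ { refl → refl }) (φ ≟ᑫ ψ)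
¬ᶠ _ ≟ᑫ _ ∧ᶠ _ = no λ ()
_ ∧ᶠ _ ≟ᑫ var _ = no λ ()
_ ∧ᶠ _ ≟ᑫ atom _ = no λ ()
_ ∧ᶠ _ ≟ᑫ ¬ᶠ _ = no λ ()
φ ∧ᶠ ψ ≟ᑫ φ′ ∧ᶠ ψ′ =
  map′ (λ (p , q) → cong₂ _∧ᶠ_ p q) (λ { refl → refl , refl })
    (φ ≟ᑫ φ′ ×-dec ψ ≟ᑫ ψ′)

------------------------------------------------------------------------
-- Semantics over finite, possibly empty, sequences of letters A ⊆ AP

Word : ℕ → Set
Word m = List (Subset (suc m))

infix 4 _⊨_ _⊨?_ _≤_ _≤?_

_⊨_ : Word m → Formula m → Set
π       ⊨ ¬ᶠ φ   = ¬ (π ⊨ φ)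
π       ⊨ φ ∧ᶠ ψ = (π ⊨ φ) × (π ⊨ ψ)
[]      ⊨ atom a = ⊥
(A ∷ _) ⊨ atom a = a Subset.∈ A

⟦_⟧ : Formula m → Pred (Word m) 0ℓ
⟦ γ ⟧ π = π ⊨ γ

Unsatisfiable : Formula m → Set
Unsatisfiable γ = Empty ⟦ γ ⟧

-- Weaker formulas are smaller.
_≤_ : Formula m → Formula m → Set
γ₁ ≤ γ₂ = ⟦ γ₂ ⟧ ⊆′ ⟦ γ₁ ⟧

_⊨?_ : (π : Word m) (γ : Formula m) → Dec (π ⊨ γ)
π       ⊨? ¬ᶠ φ   = ¬? (π ⊨? φ)
π       ⊨? φ ∧ᶠ ψ = (π ⊨? φ) ×-dec (π ⊨? ψ)
[]      ⊨? atom a = no λ ()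
(A ∷ _) ⊨? atom a = a Subset.∈? A

-- Two words agreeing on all atoms agree on all formulas; in particular
-- only the first letter matters.
⊨-atoms : (π ρ : Word m) → (∀ a → π ⊨ atom a ⇔ ρ ⊨ atom a) →
          ∀ γ → π ⊨ γ ⇔ ρ ⊨ γ
⊨-atoms π ρ e (atom a) = e a
⊨-atoms π ρ e (¬ᶠ φ)   = let i = ⊨-atoms π ρ e φ in
  mk⇔ (λ n p → n (from i p)) (λ n p → n (to i p))
⊨-atoms π ρ e (φ ∧ᶠ ψ) = let i = ⊨-atoms π ρ e φ; j = ⊨-atoms π ρ e ψ in
  mk⇔ (λ (p , q) → to i p , to j q) (λ (p , q) → from i p , from j q)

⊨-head : (A : Subset (suc m)) (π : Word m) → ∀ γ → (A ∷ π) ⊨ γ ⇔ [ A ] ⊨ γ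
⊨-head A π = ⊨-atoms (A ∷ π) [ A ] (λ a → mk⇔ (λ p → p) (λ p → p))

⊨-subst : (π : Word m) (q : Query m) (γ γ′ : Formula m) →
          (π ⊨ γ ⇔ π ⊨ γ′) → π ⊨ q ⟨ γ ⟩ ⇔ π ⊨ q ⟨ γ′ ⟩
⊨-subst π (var _)  γ γ′ e = e
⊨-subst π (atom a) γ γ′ e = mk⇔ (λ p → p) (λ p → p)
⊨-subst π (¬ᶠ φ)   γ γ′ e = let i = ⊨-subst π φ γ γ′ e in
  mk⇔ (λ n p → n (from i p)) (λ n p → n (to i p))
⊨-subst π (φ ∧ᶠ ψ) γ γ′ e =
  let i = ⊨-subst π φ γ γ′ e; j = ⊨-subst π ψ γ γ′ e in
  mk⇔ (λ (p , q) → to i p , to j q) (λ (p , q) → from i p , from j q)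

⊭false : (π : Word m) → ¬ (π ⊨ falseᶠ)
⊭false π (p , n) = n p

enabled? : (γ : Formula m) → Dec (∃[ A ] [ A ] ⊨ γ)
enabled? γ = Subset.anySubset? (λ A → [ A ] ⊨? γ)

unsatisfiable? : (γ : Formula m) → Dec (Unsatisfiable γ)
unsatisfiable? γ with [] ⊨? γ | enabled? γ
... | yes p | _           = no λ u → u [] p
... | no _  | yes (A , p) = no λ u → u [ A ] p
... | no ¬p | no ¬q       = yes λ
  { []      → ¬p
  ; (A ∷ π) → λ p → ¬q (A , to (⊨-head A π γ) p) }

_≤?_ : (γ₁ γ₂ : Formula m) → Dec (γ₁ ≤ γ₂)
γ₁ ≤? γ₂ = map′
  (λ u π p → decidable-stable (π ⊨? γ₁) (λ n → u π (p , n)))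
  (λ l π (p , n) → n (l π p))
  (unsatisfiable? (γ₂ ∧ᶠ ¬ᶠ γ₁))

≤-trans : {γ₁ γ₂ γ₃ : Formula m} → γ₁ ≤ γ₂ → γ₂ ≤ γ₃ → γ₁ ≤ γ₃
≤-trans p q π x = p π (q π x)

true≤ : (γ : Formula m) → trueᶠ ≤ γ
true≤ γ π _ = ⊭false π

≤false : (γ : Formula m) → γ ≤ falseᶠ
≤false γ π f = ⊥-elim (⊭false π f)

------------------------------------------------------------------------
-- Propositional intervals

record Interval (m : ℕ) : Set where
  constructor ⟪_,_⟫
  field
    lower upper : Formula m

open Interval public

infix 4 _∈ᴵ_

_∈ᴵ_ : Formula m → Interval m → Set
γ ∈ᴵ J = (lower J ≤ γ) × (γ ≤ upper J)

⟦_⟧ᴵ : Interval m → Pred (Formula m) 0ℓ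
⟦ J ⟧ᴵ γ = γ ∈ᴵ J

fullᴵ : Interval m
fullᴵ = ⟪ trueᶠ , falseᶠ ⟫

⋀ᴵ : List (Interval m) → Interval m
⋀ᴵ Js = ⟪ ⋀ᶠ (map lower Js) , ⋁ᶠ (map upper Js) ⟫

infixr 8 _⊓_

_⊓_ : Interval m → Interval m → Interval m
J ⊓ K = ⟪ lower J ∧ᶠ lower K , upper J ∨ᶠ upper K ⟫

⊓-∩ : (J K : Interval m) → ⟦ J ⊓ K ⟧ᴵ ≐′ (⟦ J ⟧ᴵ ∩ ⟦ K ⟧ᴵ)
⊓-∩ J K =
  (λ γ (l , u) → ((λ π p → proj₁ (l π p)) , (λ π p → u π (λ n → proj₁ n p))) ,
                 ((λ π p → proj₂ (l π p)) , (λ π p → u π (λ n → proj₂ n p)))) ,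
  (λ γ ((l , u) , (l′ , u′)) →
    (λ π p → l π p , l′ π p) ,
    (λ π n → decidable-stable (π ⊨? γ)
               (λ ¬p → n ((λ p → ¬p (u π p)) , (λ p → ¬p (u′ π p))))))

nonempty? : (J : Interval m) → Dec (Satisfiable ⟦ J ⟧ᴵ)
nonempty? J = map′
  (λ l → lower J , (λ π p → p) , l)
  (λ (γ , l , u) → ≤-trans {γ₁ = lower J} {γ} {upper J} l u)
  (lower J ≤? upper J)

-- The two classes of formulas according to their value on ε.

[true]∼ε : Pred (Formula m) 0ℓ
[true]∼ε γ = [] ⊨ γ

[false]∼ε : Pred (Formula m) 0ℓ
[false]∼ε γ = ¬ ([] ⊨ γ)

trueᴵ : Interval m
trueᴵ = ⟪ trueᶠ , ⋀ᶠ (map (λ a → ¬ᶠ atom a) (allFin _)) ⟫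

falseᴵ : Interval m
falseᴵ = ⟪ ⋁ᶠ (map atom (allFin _)) , falseᶠ ⟫

⋀¬-intro : (π : Word m) (as : List (Fin (suc m))) →
           (∀ a → ¬ (π ⊨ atom a)) → π ⊨ ⋀ᶠ (map (λ a → ¬ᶠ atom a) as)
⋀¬-intro π []       n = ⊭false π
⋀¬-intro π (a ∷ as) n = n a , ⋀¬-intro π as n

⋀¬-elim : (π : Word m) (as : List (Fin (suc m))) →
          π ⊨ ⋀ᶠ (map (λ a → ¬ᶠ atom a) as) → ∀ {a} → a ∈ as → ¬ (π ⊨ atom a)
⋀¬-elim π (_ ∷ as) (n , _) (here refl) = n
⋀¬-elim π (_ ∷ as) (_ , p) (there i)   = ⋀¬-elim π as p i

⋁-intro : (π : Word m) (as : List (Fin (suc m))) →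
          ∀ {a} → a ∈ as → π ⊨ atom a → π ⊨ ⋁ᶠ (map atom as)
⋁-intro π (_ ∷ as) (here refl) p (n , _) = n p
⋁-intro π (_ ∷ as) (there i)   p (_ , n) = n (⋁-intro π as i p)

ε⊭⋁ : (as : List (Fin (suc m))) → ¬ ([] ⊨ ⋁ᶠ (map atom as))
ε⊭⋁ []       (p , _) = p
ε⊭⋁ (_ ∷ as) n = n ((λ ()) , ε⊭⋁ as)

⊨-ε : (π : Word m) → (∀ a → ¬ (π ⊨ atom a)) → ∀ γ → π ⊨ γ ⇔ [] ⊨ γ
⊨-ε π n = ⊨-atoms π [] (λ a → mk⇔ (n a) (λ ()))

trueᴵ-correct : [true]∼ε ≐′ ⟦ trueᴵ {m} ⟧ᴵ
trueᴵ-correct =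
  (λ γ p → true≤ γ ,
    (λ π c → from (⊨-ε π (λ a → ⋀¬-elim π (allFin _) c (∈-allFin a)) γ) p)) ,
  (λ γ (_ , u) → u [] (⋀¬-intro [] (allFin _) (λ a p → p)))

falseᴵ-correct : [false]∼ε ≐′ ⟦ falseᴵ {m} ⟧ᴵ
falseᴵ-correct =
  (λ γ n →
    (λ π p → decidable-stable (π ⊨? ⋁ᶠ (map atom (allFin _))) (λ ¬d →
      n (to (⊨-ε π (λ a q → ¬d (⋁-intro π (allFin _) (∈-allFin a) q)) γ) p))) ,
    ≤false γ) ,
  (λ γ (l , _) p → ε⊭⋁ (allFin _) (l [] p))

∩-nonempty? : (J K : Interval m) {P : Pred (Formula m) 0ℓ} → P ≐′ ⟦ K ⟧ᴵ →
              Dec (Satisfiable (⟦ J ⟧ᴵ ∩ P))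
∩-nonempty? J K (P⊆K , K⊆P) = map′
  (λ (γ , i) → let (j , l) = proj₁ (⊓-∩ J K) γ i in γ , j , K⊆P γ l)
  (λ (γ , j , p) → γ , proj₂ (⊓-∩ J K) γ (j , P⊆K γ p))
  (nonempty? (J ⊓ K))

------------------------------------------------------------------------
-- Shattering of queries

_Shatters_ : Formula m → Query m → Set
γ′ Shatters q = Unsatisfiable (q ⟨ γ′ ⟩)

Shattering : Query m → Pred (Formula m) 0ℓ
Shattering q γ′ = γ′ Shatters q

-- Since q[γ′] is equivalent to (γ′ ∧ q[true]) ∨ (¬γ′ ∧ q[false]), the
-- formula γ′ shatters q iff γ′ implies ¬q[true] and q[false] implies γ′.
shatteringInterval : Query m → Interval m
shatteringInterval q = ⟪ ¬ᶠ (q ⟨ trueᶠ ⟩) , q ⟨ falseᶠ ⟩ ⟫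

shatteringInterval-correct : (q : Query m) →
  Shattering q ≐′ ⟦ shatteringInterval q ⟧ᴵ
shatteringInterval-correct q =
  (λ γ u →
    (λ π p t → u π (from (sub⊤ γ π p) t)) ,
    (λ π f → decidable-stable (π ⊨? γ) (λ n → u π (from (sub⊥ γ π n) f)))) ,
  (λ γ (l , u) π s → ⊥-elim (lem γ l u π s (π ⊨? γ)))
  where
  sub⊤ : ∀ γ π → π ⊨ γ → π ⊨ q ⟨ γ ⟩ ⇔ π ⊨ q ⟨ trueᶠ ⟩
  sub⊤ γ π p = ⊨-subst π q γ trueᶠ (mk⇔ (λ _ → ⊭false π) (λ _ → p))

  sub⊥ : ∀ γ π → ¬ (π ⊨ γ) → π ⊨ q ⟨ γ ⟩ ⇔ π ⊨ q ⟨ falseᶠ ⟩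
  sub⊥ γ π n = ⊨-subst π q γ falseᶠ (mk⇔ (λ p → ⊥-elim (n p)) (λ f → ⊥-elim (⊭false π f)))

  lem : ∀ γ → ¬ᶠ (q ⟨ trueᶠ ⟩) ≤ γ → γ ≤ q ⟨ falseᶠ ⟩ →
        ∀ π → π ⊨ q ⟨ γ ⟩ → Dec (π ⊨ γ) → ⊥
  lem γ l u π s (yes p) = l π p (to (sub⊤ γ π p) s)
  lem γ l u π s (no n)  = n (u π (to (sub⊥ γ π n) s))

shattering-empty? : (q : Query m) → Dec (Empty (Shattering q))
shattering-empty? q with nonempty? (shatteringInterval q)
... | yes (γ , i) = no λ e → e γ (proj₂ (shatteringInterval-correct q) γ i)
... | no n        = yes λ γ s → n (γ , proj₁ (shatteringInterval-correct q) γ s)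

shattering-full? : (q : Query m) → Dec (Shattering q ≐′ ⟦ fullᴵ ⟧ᴵ)
shattering-full? {m} q = map′
  (λ (t , f) →
    (λ γ _ → true≤ γ , ≤false γ) ,
    (λ γ _ → proj₂ correct γ
       ( ≤-trans {γ₁ = lower J} {trueᶠ} {γ} (proj₁ (proj₁ correct trueᶠ t)) (true≤ γ)
       , ≤-trans {γ₁ = γ} {falseᶠ} {upper J} (≤false γ) (proj₂ (proj₁ correct falseᶠ f)))))
  (λ (_ , full) → full trueᶠ (true≤ trueᶠ , ≤false trueᶠ)
                , full falseᶠ (true≤ falseᶠ , ≤false falseᶠ))
  (unsatisfiable? (q ⟨ trueᶠ ⟩) ×-dec unsatisfiable? (q ⟨ falseᶠ ⟩))
  where
  J       = shatteringInterval q
  correct = shatteringInterval-correct q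

------------------------------------------------------------------------
-- Automata over k states with a finite transition relation

record PNFA (m k : ℕ) : Set where
  field
    q-init : Fin k
    δ      : List (Fin k × Formula m × Fin k)
    F      : Subset k

Accepts : PNFA m k → Fin k → Word m → Set
Accepts M q []      = q Subset.∈ PNFA.F M
Accepts M q (A ∷ w) = ∃₂ λ γ q′ →
  (q , γ , q′) ∈ PNFA.δ M × [ A ] ⊨ γ × Accepts M q′ w

L : PNFA m k → Pred (Word m) 0ℓ
L M w = Accepts M (PNFA.q-init M) w

record FQA (m k : ℕ) : Set where
  field
    q-init : Fin k
    δ      : List (Fin k × Query m × Fin k)
    F      : Fin k → Query m

acceptingAt : FQA m k → Formula m → Subset k
acceptingAt M γ = tabulate (λ q → does ([] ⊨? FQA.F M q ⟨ γ ⟩))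

infix 10 _⟨_⟩ᴹ

_⟨_⟩ᴹ : FQA m k → Formula m → PNFA m k
M ⟨ γ ⟩ᴹ = record
  { q-init = FQA.q-init M
  ; δ      = map (λ (q , γ′ , q′) → q , γ′ ⟨ γ ⟩ , q′) (FQA.δ M)
  ; F      = acceptingAt M γ
  }

_ShattersFQA_ : Formula m → FQA m k → Set
γ ShattersFQA M = Empty (L (M ⟨ γ ⟩ᴹ))

------------------------------------------------------------------------
-- Emptiness of the language of a PNFA is decidable

-- The states accepting some word form the least set that contains F and
-- is closed under predecessors along satisfiable transitions.
module Emptiness (M : PNFA m k) where
  open PNFA M

  Productive : Fin k → Set
  Productive q = ∃[ w ] Accepts M q w

  StepInto : Subset k → Fin k → Set
  StepInto S q =
    Any (λ (p , γ , p′) → p ≡ q × (∃[ A ] [ A ] ⊨ γ) × p′ Subset.∈ S) δ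

  stepInto? : ∀ S q → Dec (StepInto S q)
  stepInto? S q = any? (λ (p , γ , p′) →
    (p Fin.≟ q) ×-dec (enabled? γ ×-dec (p′ Subset.∈? S))) δ

  Sound : Subset k → Set
  Sound S = ∀ q → q Subset.∈ S → Productive q

  Closed : Subset k → Set
  Closed S = F Subset.⊆ S × (∀ q → StepInto S q → q Subset.∈ S)

  step-sound : ∀ {S} → Sound S → ∀ q → StepInto S q → Productive q
  step-sound sound q s with find s
  ... | (_ , γ , q′) , t∈δ , refl , (A , A⊨γ) , q′∈S =
    let (w , acc-w) = sound q′ q′∈S in A ∷ w , γ , q′ , t∈δ , A⊨γ , acc-w

  saturate : ∀ S → Acc Subset._⊃_ S → F Subset.⊆ S → Sound S →
             ∃[ T ] Sound T × Closed T
  saturate S (acc rec) F⊆S sound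
    with Fin.any? (λ q → ¬? (q Subset.∈? S) ×-dec stepInto? S q)
  ... | no closed = S , sound , F⊆S , λ q s →
    decidable-stable (q Subset.∈? S) (λ q∉S → closed (q , q∉S , s))
  ... | yes (q , q∉S , s) =
    saturate S′ (rec (S⊆S′ , q , q∈S′ , q∉S)) (S⊆S′ ∘ F⊆S)
      (λ p p∈S′ → [ sound p , new p ]′ (Subset.x∈p∪q⁻ S ⁅ q ⁆ p∈S′))
    where
    S′ = S Subset.∪ ⁅ q ⁆

    S⊆S′ : S Subset.⊆ S′
    S⊆S′ = Subset.p⊆p∪q ⁅ q ⁆

    q∈S′ : q Subset.∈ S′
    q∈S′ = Subset.q⊆p∪q S ⁅ q ⁆ (Subset.x∈⁅x⁆ q)

    new : ∀ p → p Subset.∈ ⁅ q ⁆ → Productive p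
    new p i with Subset.x∈⁅y⁆⇒x≡y q i
    ... | refl = step-sound sound q s

  complete : ∀ {S} → Closed S → ∀ q w → Accepts M q w → q Subset.∈ S
  complete (F⊆S , _) q [] q∈F = F⊆S q∈F
  complete cl@(_ , step) q (A ∷ w) (γ , q′ , t∈δ , A⊨γ , acc-w) =
    step q (lose t∈δ (refl , (A , A⊨γ) , complete cl q′ w acc-w))

  empty? : Dec (Empty (L M))
  empty? with saturate F (⊃-wellFounded F) (λ i → i) (λ q i → [] , i)
  ... | T , sound , closed with q-init Subset.∈? T
  ...   | yes i = let (w , p) = sound q-init i in no λ e → e w p
  ...   | no n  = yes λ w p → n (complete closed q-init w p)

open Emptiness public using (empty?)

------------------------------------------------------------------------
-- The procedure ShatterFQA

-- Finite sets are represented by lists.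

sublists : {A : Set} → List A → List (List A)
sublists []       = [ [] ]
sublists (x ∷ xs) = sublists xs ++ map (x ∷_) (sublists xs)

infix 4 _∈?_

_∈?_ : (q : Query m) (qs : List (Query m)) → Dec (q ∈ qs)
_∈?_ = DecMembership._∈?_ _≟ᑫ_

module Procedure (M : FQA m k) where
  open FQA M

  TL UL DL SL : List (Query m)
  TL = deduplicate _≟ᑫ_ (map (λ (_ , γ , _) → γ) δ)
  UL = filter shattering-empty? TL
  DL = filter shattering-full? TL
  SL = filter (λ γ → ¬? (γ ∈? UL ++ DL)) TL

  δ′ : List (Fin k × Query m × Fin k)
  δ′ = filter (λ (_ , γ , _) → γ ∈? SL) δ
    ++ map (λ (q , _ , q′) → q , trueᶠ , q′) (filter (λ (_ , γ , _) → γ ∈? UL) δ)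

  module ForSubset (S : List (Query m)) where

    I : Interval m
    I = ⋀ᴵ (map shatteringInterval S)

    δ″ : List (Fin k × Formula m × Fin k)
    δ″ = map (λ (q , _ , q′) → q , trueᶠ , q′)
           (filter (λ (_ , γ , _) → ¬? (γ ∈? S)) δ′)

    Mₜ M_f : PNFA m k
    Mₜ  = record { q-init = q-init ; δ = δ″ ; F = acceptingAt M trueᶠ }
    M_f = record { q-init = q-init ; δ = δ″ ; F = acceptingAt M falseᶠ }

    test-true : Dec (Satisfiable (⟦ I ⟧ᴵ ∩ [true]∼ε) × Empty (L Mₜ))
    test-true = ∩-nonempty? I trueᴵ trueᴵ-correct ×-dec empty? Mₜ

    test-false : Dec (Satisfiable (⟦ I ⟧ᴵ ∩ [false]∼ε) × Empty (L M_f))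
    test-false = ∩-nonempty? I falseᴵ falseᴵ-correct ×-dec empty? M_f

    -- The two intervals are added only if non-empty and are disjoint, so
    -- the length of this list is the cardinality of the set it represents.
    PSC : List (Interval m)
    PSC = (if does test-true  then [ I ⊓ trueᴵ ]  else [])
       ++ (if does test-false then [ I ⊓ falseᴵ ] else [])

    contribution : List (Interval m)
    contribution = if does (length PSC ≟ 2) then [ I ] else PSC

ShatterFQA : FQA m k → List (Interval m)
ShatterFQA M = concatMap ForSubset.contribution (sublists SL)
  where open Procedure M

{-# OPTIONS --safe #-}

-- Write v for true or false, whichever agrees with γ on ε.  Then M[γ] and
-- (Q, AP, q_I, δ″, F[v]) have the same final states.  If S consists of labels
-- shattered by γ, every transition of M[γ] enabled by some letter occurs in δ″,
-- since its label is neither in DL nor in S; if S contains all labels of SL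
-- shattered by γ, conversely every transition of δ″ comes from one of M[γ]
-- enabled by some letter.  Emptiness depends only on which transitions are
-- enabled, not on the letters, so it passes from one automaton to the other.
module Submission where

open import Defs
open import Data.Bool using (if_then_else_)
open import Data.Empty using (⊥-elim)
open import Data.Fin using (Fin)
import Data.Fin.Subset as Subset
import Data.Fin.Subset.Properties as Subset
open import Data.List using (List; []; _∷_; [_]; _++_; map; filter; length)
open import Data.List.Membership.Propositional using (_∈_; find; lose)
open import Data.List.Membership.Propositional.Properties
  using (∈-map⁺; ∈-map⁻; ∈-++⁺ˡ; ∈-++⁺ʳ; ∈-++⁻; ∈-filter⁺; ∈-filter⁻;
         ∈-concatMap⁺; ∈-concatMap⁻; ∈-deduplicate⁺)
open import Data.List.Relation.Unary.All as All using (All; []; _∷_)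
import Data.List.Relation.Unary.All.Properties as All
open import Data.List.Relation.Unary.Any using (here; there)
open import Data.Nat using (ℕ; _≟_)
open import Data.Product using (∃-syntax; _×_; _,_; proj₁; proj₂)
open import Data.Sum using (_⊎_; inj₁; inj₂; [_,_]′)
open import Data.Vec.Properties using (tabulate-cong)
open import Function using (_⇔_; mk⇔; Equivalence; _∘_)
open import Relation.Binary.PropositionalEquality using (_≡_; refl; sym; subst)
open import Relation.Nullary using (¬_; Dec; yes; no; does; ¬?; contradiction)
open import Relation.Nullary.Decidable using (does-⇔)
open import Relation.Unary using (Decidable; Empty; Satisfiable; _∩_)

open Equivalence using (to; from)

private variable
  A : Set

-- Sublists and relabelled transition lists.

-- Ensures that the procedure visits the set of all labels of `SL` shattered by a given formula.
filter∈sublists : ∀ {P : A → Set} (P? : Decidable P) xs → filter P? xs ∈ sublists xs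
filter∈sublists P? []       = here refl
filter∈sublists P? (x ∷ xs) with P? x
... | yes _ = ∈-++⁺ʳ (sublists xs) (∈-map⁺ (x ∷_) (filter∈sublists P? xs))
... | no  _ = ∈-++⁺ˡ (filter∈sublists P? xs)

sublists-⊆ : ∀ (xs : List A) {ys} → ys ∈ sublists xs → ∀ {y} → y ∈ ys → y ∈ xs
sublists-⊆ []       (here refl) ()
sublists-⊆ (x ∷ xs) i j with ∈-++⁻ (sublists xs) i
... | inj₁ i′ = there (sublists-⊆ xs i′ j)
... | inj₂ i′ with ∈-map⁻ (x ∷_) i′
...   | zs , i″ , refl with j
...     | here refl = here refl
...     | there j′  = there (sublists-⊆ xs i″ j′)

∈-mapLabels⁺ : {X Y Z : Set} (f : X → Y) (ts : List (Z × X × Z)) → ∀ {p x p′} →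
  (p , x , p′) ∈ ts → (p , f x , p′) ∈ map (λ (p , x , p′) → p , f x , p′) ts
∈-mapLabels⁺ f ts = ∈-map⁺ (λ (p , x , p′) → p , f x , p′)

∈-mapLabels⁻ : {X Y Z : Set} (f : X → Y) (ts : List (Z × X × Z)) → ∀ {p y p′} →
  (p , y , p′) ∈ map (λ (p , x , p′) → p , f x , p′) ts →
  ∃[ x ] ((p , x , p′) ∈ ts × y ≡ f x)
∈-mapLabels⁻ f ts i with ∈-map⁻ (λ (p , x , p′) → p , f x , p′) i
... | (_ , x , _) , j , refl = x , j , refl

-- Satisfiable formulas and enabling letters.

Enabled : Formula m → Set
Enabled γ = ∃[ A ] [ A ] ⊨ γ

enabled⇒satisfiable : (γ : Formula m) → Enabled γ → ¬ Unsatisfiable γ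
enabled⇒satisfiable γ (A , p) u = u [ A ] p

-- ε satisfies the same formulas as the one-letter word ∅.
satisfiable⇒enabled : (γ : Formula m) → ¬ Unsatisfiable γ → Enabled γ
satisfiable⇒enabled γ s with enabled? γ
... | yes e = e
... | no ¬e = contradiction (λ
  { []      p → ¬e (Subset.⊥ , from (⊨-ε [ Subset.⊥ ] (λ _ → Subset.∉⊥) γ) p)
  ; (A ∷ π) p → ¬e (A , to (⊨-head A π γ) p) }) s

true-satisfiable : ¬ Unsatisfiable (trueᶠ {m = m})
true-satisfiable {m} u = u [] (⊭false {m} [])

-- Shattering intervals and final states.

-- `⋀ᴵ (J ∷ Js)` unfolds to `J ⊓ ⋀ᴵ Js`, so `⊓-∩` gives the induction step.
∈⋀ᴵ⇔All : (γ : Formula m) (Js : List (Interval m)) → γ ∈ᴵ ⋀ᴵ Js ⇔ All (γ ∈ᴵ_) Js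
∈⋀ᴵ⇔All γ [] = mk⇔ (λ _ → []) (λ _ → true≤ γ , ≤false γ)
∈⋀ᴵ⇔All γ (J ∷ Js) = mk⇔
  (λ i → let (j , js) = proj₁ (⊓-∩ J (⋀ᴵ Js)) γ i in j ∷ to (∈⋀ᴵ⇔All γ Js) js)
  (λ { (j ∷ js) → proj₂ (⊓-∩ J (⋀ᴵ Js)) γ (j , from (∈⋀ᴵ⇔All γ Js) js) })

∈⋀shattering⇔ : (γ : Formula m) (S : List (Query m)) →
  γ ∈ᴵ ⋀ᴵ (map shatteringInterval S) ⇔ (∀ {q} → q ∈ S → γ Shatters q)
∈⋀shattering⇔ γ S = mk⇔
  (λ i {q} q∈S → proj₂ (shatteringInterval-correct q) γ
    (All.lookup (All.map⁻ (to (∈⋀ᴵ⇔All γ (map shatteringInterval S)) i)) q∈S))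
  (λ h → from (∈⋀ᴵ⇔All γ (map shatteringInterval S))
    (All.map⁺ (All.tabulate (λ {q} q∈S → proj₁ (shatteringInterval-correct q) γ (h q∈S)))))

shatters? : (γ : Formula m) → Decidable (γ Shatters_)
shatters? γ q = unsatisfiable? (q ⟨ γ ⟩)

-- At ε a query sees only the truth value there of the formula put for `var`.
acceptingAt-cong : (M : FQA m k) (γ γ′ : Formula m) → ([] ⊨ γ ⇔ [] ⊨ γ′) →
                   acceptingAt M γ ≡ acceptingAt M γ′
acceptingAt-cong M γ γ′ e = tabulate-cong λ q →
  does-⇔ (⊨-subst [] (FQA.F M q) γ γ′ e)
    ([] ⊨? FQA.F M q ⟨ γ ⟩) ([] ⊨? FQA.F M q ⟨ γ′ ⟩)

-- Transfer of accepted words between automata.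

module _ (N N′ : PNFA m k) where

  EnabledIncluded : Set
  EnabledIncluded = ∀ {q γ q′} → (q , γ , q′) ∈ PNFA.δ N → Enabled γ →
    ∃[ γ′ ] ((q , γ′ , q′) ∈ PNFA.δ N′ × Enabled γ′)

  -- The run keeps its states, while each letter is replaced by one enabling the matching transition
  -- of `N′`.
  productive-mono : PNFA.F N ≡ PNFA.F N′ → EnabledIncluded →
    ∀ q w → Accepts N q w → ∃[ w′ ] Accepts N′ q w′
  productive-mono F≡ inc q []      p = [] , subst (q Subset.∈_) F≡ p
  productive-mono F≡ inc q (A ∷ w) (γ , q′ , t , A⊨γ , p) =
    let (γ′ , t′ , (B , B⊨γ′)) = inc t (A , A⊨γ)
        (w′ , p′)              = productive-mono F≡ inc q′ w p
    in B ∷ w′ , γ′ , q′ , t′ , B⊨γ′ , p′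

-- Classes of labels, and the transitions kept for a set `S`.

module _ (M : FQA m k) where
  open FQA M
  open Procedure M

  -- Transitions labelled in UL are relabelled true before those with label in S
  -- are dropped; they survive because S ⊆ SL.
  true∉SL : ¬ (trueᶠ ∈ SL)
  true∉SL i =
    let (t∈TL , t∉) = ∈-filter⁻ (λ γ → ¬? (γ ∈? UL ++ DL)) {xs = TL} i
    in t∉ (∈-++⁺ˡ (∈-filter⁺ shattering-empty? t∈TL (λ _ → true-satisfiable)))

  UL-unshattered : ∀ {q} → q ∈ UL → ∀ γ → ¬ (γ Shatters q)
  UL-unshattered i = proj₂ (∈-filter⁻ shattering-empty? {xs = TL} i)

  DL-shattered : ∀ {q} → q ∈ DL → ∀ γ → γ Shatters q
  DL-shattered i γ =
    proj₂ (proj₂ (∈-filter⁻ shattering-full? {xs = TL} i)) γ (true≤ γ , ≤false γ)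

  -- The only other class is `DL`, whose labels every formula shatters.
  unshattered∈SL⊎UL : (γ : Formula m) → ∀ {p q p′} → (p , q , p′) ∈ δ →
                      ¬ (γ Shatters q) → q ∈ SL ⊎ q ∈ UL
  unshattered∈SL⊎UL γ {q = q} t ¬s =
    decide (∈-deduplicate⁺ _≟ᑫ_ (∈-map⁺ (λ (_ , q , _) → q) t)) (q ∈? UL ++ DL)
    where
    decide : q ∈ TL → Dec (q ∈ UL ++ DL) → q ∈ SL ⊎ q ∈ UL
    decide q∈TL (no ¬i) = inj₁ (∈-filter⁺ (λ γ → ¬? (γ ∈? UL ++ DL)) q∈TL ¬i)
    decide q∈TL (yes i) =
      [ inj₂ , (λ d → contradiction (DL-shattered d γ) ¬s) ]′ (∈-++⁻ UL i)

  module _ (γ : Formula m) (S : List (Query m)) (v : Formula m) where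
    open ForSubset S

    private
      -- This is `Mₜ` for `v = trueᶠ` and `M_f` for `v = falseᶠ`, so one argument serves both tests.
      N : PNFA m k
      N = record { q-init = q-init ; δ = δ″ ; F = acceptingAt M v }

      inSL : (t : Fin k × Query m × Fin k) → Dec (proj₁ (proj₂ t) ∈ SL)
      inSL (_ , q , _) = q ∈? SL

      inUL : (t : Fin k × Query m × Fin k) → Dec (proj₁ (proj₂ t) ∈ UL)
      inUL (_ , q , _) = q ∈? UL

      notInS : (t : Fin k × Query m × Fin k) → Dec (¬ (proj₁ (proj₂ t) ∈ S))
      notInS (_ , q , _) = ¬? (q ∈? S)

      δ″-enabled : ∀ {p q p′} → (p , q , p′) ∈ δ′ → ¬ (q ∈ S) →
                   ∃[ φ ] ((p , φ , p′) ∈ δ″ × Enabled φ)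
      δ″-enabled t q∉S =
        trueᶠ , ∈-mapLabels⁺ (λ _ → trueᶠ) (filter notInS δ′) (∈-filter⁺ notInS t q∉S) ,
        satisfiable⇒enabled trueᶠ true-satisfiable

      -- A label from `SL` outside `S` is unshattered because `S` holds all shattered ones. A
      -- transition relabelled true gets back its original label in `UL`, which no formula shatters.
      δ′-unshattered : (∀ {q} → q ∈ SL → γ Shatters q → q ∈ S) →
        ∀ {p q p′} → (p , q , p′) ∈ δ′ → ¬ (q ∈ S) →
        ∃[ q₀ ] ((p , q₀ , p′) ∈ δ × ¬ (γ Shatters q₀))
      δ′-unshattered full {q = q} t q∉S =
        [ (λ i → let (t∈δ , s) = ∈-filter⁻ inSL {xs = δ} i
                 in q , t∈δ , q∉S ∘ full s)
        , (λ i → let (q₀ , i′ , _) = ∈-mapLabels⁻ (λ _ → trueᶠ) (filter inUL δ) i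
                     (t∈δ , u)     = ∈-filter⁻ inUL {xs = δ} i′
                 in q₀ , t∈δ , UL-unshattered u γ)
        ]′ (∈-++⁻ (filter inSL δ) t)

    instance-⊆-δ″ : (∀ {q} → q ∈ S → q ∈ SL) → (∀ {q} → q ∈ S → γ Shatters q) →
                    EnabledIncluded (M ⟨ γ ⟩ᴹ) N
    instance-⊆-δ″ S⊆SL sh t e =
      let (q , t∈δ , eq) = ∈-mapLabels⁻ _⟨ γ ⟩ δ t
          ¬s             = enabled⇒satisfiable (q ⟨ γ ⟩) (subst Enabled eq e)
      in [ (λ s → δ″-enabled (∈-++⁺ˡ (∈-filter⁺ inSL t∈δ s)) (¬s ∘ sh))
         , (λ u → δ″-enabled
                    (∈-++⁺ʳ (filter inSL δ)
                      (∈-mapLabels⁺ (λ _ → trueᶠ) (filter inUL δ) (∈-filter⁺ inUL t∈δ u)))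
                    (true∉SL ∘ S⊆SL))
         ]′ (unshattered∈SL⊎UL γ t∈δ ¬s)

    δ″-⊆-instance : (∀ {q} → q ∈ SL → γ Shatters q → q ∈ S) →
                    EnabledIncluded N (M ⟨ γ ⟩ᴹ)
    δ″-⊆-instance full t _ =
      let (_ , t∈ , _)     = ∈-mapLabels⁻ (λ _ → trueᶠ) (filter notInS δ′) t
          (t∈δ′ , q∉S)     = ∈-filter⁻ notInS {xs = δ′} t∈
          (q₀ , t∈δ , ¬s)  = δ′-unshattered full t∈δ′ q∉S
      in q₀ ⟨ γ ⟩ , ∈-mapLabels⁺ _⟨ γ ⟩ δ t∈δ , satisfiable⇒enabled (q₀ ⟨ γ ⟩) ¬s

    empty⇒shatters : ([] ⊨ γ ⇔ [] ⊨ v) →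
      (∀ {q} → q ∈ S → q ∈ SL) → (∀ {q} → q ∈ S → γ Shatters q) →
      Empty (L N) → γ ShattersFQA M
    empty⇒shatters e S⊆SL sh em w p =
      let (w′ , p′) = productive-mono (M ⟨ γ ⟩ᴹ) N (acceptingAt-cong M γ v e)
                        (instance-⊆-δ″ S⊆SL sh) q-init w p
      in em w′ p′

    shatters⇒empty : ([] ⊨ γ ⇔ [] ⊨ v) →
      (∀ {q} → q ∈ SL → γ Shatters q → q ∈ S) →
      γ ShattersFQA M → Empty (L N)
    shatters⇒empty e full s w p =
      let (w′ , p′) = productive-mono N (M ⟨ γ ⟩ᴹ) (sym (acceptingAt-cong M γ v e))
                        (δ″-⊆-instance full) q-init w p
      in s w′ p′

-- Intervals contributed by one set of labels.

module _ (I : Interval m) {P Q : Set} where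

  -- contribution with its two tests abstracted: case analysis on the concrete
  -- tests would unfold them.
  merge : Dec P → Dec Q → List (Interval m)
  merge p? q? = if does (length psc ≟ 2) then [ I ] else psc
    where
    psc = (if does p? then [ I ⊓ trueᴵ ] else []) ++ (if does q? then [ I ⊓ falseᴵ ] else [])

  ∈merge⁻ : (γ : Formula m) (p? : Dec P) (q? : Dec Q) {J : Interval m} →
            J ∈ merge p? q? → γ ∈ᴵ J →
            γ ∈ᴵ I × ([] ⊨ γ × P ⊎ ¬ ([] ⊨ γ) × Q)
  -- Here the list is just `[ I ]`, which does not fix the value at ε; `γ` itself decides which test
  -- applies.
  ∈merge⁻ γ (yes p) (yes q) (here refl) i with [] ⊨? γ
  ... | yes t = i , inj₁ (t , p)
  ... | no ¬t = i , inj₂ (¬t , q)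
  ∈merge⁻ γ (yes p) (no _) (here refl) i =
    let (j , t) = proj₁ (⊓-∩ I trueᴵ) γ i in j , inj₁ (proj₂ trueᴵ-correct γ t , p)
  ∈merge⁻ γ (no _) (yes q) (here refl) i =
    let (j , f) = proj₁ (⊓-∩ I falseᴵ) γ i in j , inj₂ (proj₂ falseᴵ-correct γ f , q)

  ∈merge⁺ : (γ : Formula m) (p? : Dec P) (q? : Dec Q) →
            γ ∈ᴵ I → [] ⊨ γ × P ⊎ ¬ ([] ⊨ γ) × Q →
            ∃[ J ] (J ∈ merge p? q? × γ ∈ᴵ J)
  ∈merge⁺ γ (yes _) (yes _) i _ = I , here refl , i
  ∈merge⁺ γ (yes _) (no _)  i (inj₁ (t , _)) =
    I ⊓ trueᴵ , here refl , proj₂ (⊓-∩ I trueᴵ) γ (i , proj₁ trueᴵ-correct γ t)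
  ∈merge⁺ γ (no _)  (yes _) i (inj₂ (f , _)) =
    I ⊓ falseᴵ , here refl , proj₂ (⊓-∩ I falseᴵ) γ (i , proj₁ falseᴵ-correct γ f)
  ∈merge⁺ γ (no ¬p) _      i (inj₁ (_ , p)) = contradiction p ¬p
  ∈merge⁺ γ _      (no ¬q) i (inj₂ (_ , q)) = contradiction q ¬q

-- Correctness of the returned intervals.

≡ε-true : (γ : Formula m) → [] ⊨ γ → [] ⊨ γ ⇔ [] ⊨ trueᶠ {m = m}
≡ε-true {m} γ t = mk⇔ (λ _ → ⊭false {m} []) (λ _ → t)

≡ε-false : (γ : Formula m) → ¬ ([] ⊨ γ) → [] ⊨ γ ⇔ [] ⊨ falseᶠ {m = m}
≡ε-false {m} γ f = mk⇔ (⊥-elim ∘ f) (⊥-elim ∘ ⊭false {m} [])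

theorem8 : ∀ {m k : ℕ} (M : FQA m k) (γ : Formula m) →
    γ ShattersFQA M ⇔ (∃[ J ] (J ∈ ShatterFQA M × γ ∈ᴵ J))
theorem8 M γ = mk⇔ complete sound
  where
  open Procedure M

  complete : γ ShattersFQA M → ∃[ J ] (J ∈ ShatterFQA M × γ ∈ᴵ J)
  complete s =
    let (J , J∈ , γ∈J) = ∈merge⁺ I γ test-true test-false γ∈I (tests ([] ⊨? γ))
    in J , ∈-concatMap⁺ ForSubset.contribution
             (lose (filter∈sublists (shatters? γ) SL) J∈) , γ∈J
    where
    -- The largest subset of `SL` whose interval contains `γ`; it leaves the fewest transitions in
    -- `δ″`.
    S = filter (shatters? γ) SL
    open ForSubset S

    γ∈I : γ ∈ᴵ I
    γ∈I = from (∈⋀shattering⇔ γ S) (proj₂ ∘ ∈-filter⁻ (shatters? γ) {xs = SL})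

    tests : Dec ([] ⊨ γ) →
            [] ⊨ γ × (Satisfiable (⟦ I ⟧ᴵ ∩ [true]∼ε) × Empty (L Mₜ)) ⊎
            ¬ ([] ⊨ γ) × (Satisfiable (⟦ I ⟧ᴵ ∩ [false]∼ε) × Empty (L M_f))
    -- `γ` itself witnesses that `I` meets its class at ε, and `∈-filter⁺` puts every shattered
    -- label of `SL` into `S`.
    tests (yes t) = inj₁ (t , (γ , γ∈I , t) ,
      shatters⇒empty M γ S trueᶠ (≡ε-true γ t) (∈-filter⁺ (shatters? γ)) s)
    tests (no ¬t) = inj₂ (¬t , (γ , γ∈I , ¬t) ,
      shatters⇒empty M γ S falseᶠ (≡ε-false γ ¬t) (∈-filter⁺ (shatters? γ)) s)

  sound : ∃[ J ] (J ∈ ShatterFQA M × γ ∈ᴵ J) → γ ShattersFQA M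
  sound (J , J∈ , γ∈J) =
    let (S , S∈ , J∈S) = find (∈-concatMap⁻ ForSubset.contribution {xs = sublists SL} J∈)
        open ForSubset S
        (γ∈I , cases)  = ∈merge⁻ I γ test-true test-false J∈S γ∈J
        sh             = to (∈⋀shattering⇔ γ S) γ∈I
    in [ (λ (t , _ , e) →
           empty⇒shatters M γ S trueᶠ (≡ε-true γ t) (sublists-⊆ SL S∈) sh e)
       , (λ (f , _ , e) →
           empty⇒shatters M γ S falseᶠ (≡ε-false γ f) (sublists-⊆ SL S∈) sh e)
       ]′ cases
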